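{- Let $\beta$ be a non-negative integer and $k$ a positive integer. If $\beta+k\equiv 0 \pmod{q-1}$, then $L(\chi_t^\beta,-k)=0$; if $\beta+k\not\equiv 0\pmod{q-1}$, then $L(\chi_t^\beta,-k)\neq 0$. Moreover, whenever $\beta+k\equiv 0\pmod{q-1}$, the zero is simple: the derivative $\frac{\partial}{\partial x}z(\chi_t^\beta,x,-k)$ does not vanish at $x=1$.
   Context: Let $q$ be a power of a prime $p$, $A=\mathbb{F}_q[\theta]$, and $A_+(d)$ the set of monic polynomials in $A$ of degree $d$. Let $t$ be an indeterminate and $\chi_t:A\to\mathbb{F}_q[t]$ the $\mathbb{F}_q$-algebra morphism with $\theta\mapsto t$; $\chi_t(a)^0:=1$. For non-negative integers $\beta,k,d$ let $S_d(\chi_t^\beta,k):=\sum_{a\in A_+(d)}\chi_t(a)^\beta a^k\in A[t]$. It is known that $S_d(\chi_t^\beta,k)=0$ for $d$ sufficiently large, so the special polynomial $z(\chi_t^\beta,x,-k):=\sum_{d\ge0}x^{ -d}S_d(\chi_t^\beta,k)$ lies in $A[t][x^{ -1}]$. Define $L(\chi_t^\beta,-k):=z(\chi_t^\beta,1,-k)\in A[t]$ (the value of Pellarin's $L$-series at $-k$). -}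

module Defs where

open import Algebra.Bundles using (CommutativeRing)
open import Algebra.Structures using (IsCommutativeRing)
import Algebra.Properties.Ring as RingProperties
import Algebra.Properties.CommutativeSemigroup as CommutativeSemigroupProperties
import Algebra.Properties.Semiring.Exp as Exp
import Algebra.Properties.Monoid.Mult as Mult
import Algebra.Properties.CommutativeMonoid.Sum as Sum
open import Data.Bool using (Bool; true; false)
open import Data.Empty using (⊥-elim)
open import Data.Fin using (Fin; zero; suc)
open import Data.Fin.Permutation using (Permutation; permutation)
open import Data.List using (List; []; _∷_; _++_; map; foldr; length; tabulate; concatMap; replicate; applyUpTo)
open import Data.List.Properties using (length-++; length-map; length-replicate)
open import Data.List.Relation.Unary.All using (All; []; _∷_)
import Data.List.Relation.Unary.All as All
import Data.List.Relation.Unary.All.Properties as AllP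
open import Data.List.Relation.Unary.Any using (Any; here; there)
import Data.List.Relation.Unary.Any as Any
import Data.List.Relation.Unary.Any.Properties as AnyP
open import Data.List.Relation.Unary.AllPairs using (AllPairs; []; _∷_)
import Data.List.Relation.Unary.AllPairs as AllPairs
import Data.List.Relation.Unary.AllPairs.Properties as AllPairsP
open import Data.Nat as ℕ using (ℕ; zero; suc; _≤_; _<_; z≤n; s≤s)
import Data.Nat.Properties as ℕ
open import Data.Product using (∃-syntax; _×_; _,_; proj₁; proj₂)
open import Function using (_∘_)
open import Function.Bundles using (Inverse)
open import Level using (Level; _⊔_) renaming (suc to lsuc)
open import Relation.Binary.PropositionalEquality as ≡ using (_≡_)
open import Relation.Nullary using (¬_)

private
  variable
    a c ℓ : Level

record FiniteField (c ℓ : Level) (q : ℕ) : Set (lsuc (c ⊔ ℓ)) where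
  field
    commutativeRing : CommutativeRing c ℓ
  open CommutativeRing commutativeRing using (Carrier; _≈_; 0#; 1#; setoid) renaming (_*_ to _·_)
  field
    1≉0         : ¬ (1# ≈ 0#)
    inverse     : (x : Carrier) → ¬ (x ≈ 0#) → ∃[ y ] (x · y ≈ 1#)
    cardinality : Inverse (≡.setoid (Fin q)) setoid

-- R[X]: coefficient lists, constant term first; trailing zeros are allowed
-- and identified away by _≈ₚ_.
module Polynomial (R : CommutativeRing c ℓ) where
  open CommutativeRing R
  open RingProperties ring using (-0#≈0#)
  open CommutativeSemigroupProperties +-commutativeSemigroup using (interchange)

  Poly : Set c
  Poly = List Carrier

  coeff : Poly → ℕ → Carrier
  coeff []      _       = 0#
  coeff (x ∷ _) zero    = x
  coeff (_ ∷ f) (suc n) = coeff f n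

  infix 4 _≈ₚ_
  record _≈ₚ_ (f g : Poly) : Set ℓ where
    constructor coeffwise
    field at : ∀ n → coeff f n ≈ coeff g n
  open _≈ₚ_ public

  infixl 6 _+ₚ_
  infixl 7 _*ₚ_
  infixr 7 _∙_

  _+ₚ_ : Poly → Poly → Poly
  []      +ₚ g       = g
  (x ∷ f) +ₚ []      = x ∷ f
  (x ∷ f) +ₚ (y ∷ g) = (x + y) ∷ (f +ₚ g)

  -ₚ_ : Poly → Poly
  -ₚ_ = map (-_)

  _∙_ : Carrier → Poly → Poly
  r ∙ f = map (r *_) f

  _*ₚ_ : Poly → Poly → Poly
  []      *ₚ g = []
  (x ∷ f) *ₚ g = x ∙ g +ₚ (0# ∷ f *ₚ g)

  0ₚ 1ₚ X : Poly
  0ₚ = []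
  1ₚ = 1# ∷ []
  X  = 0# ∷ 1# ∷ []

  C : Carrier → Poly
  C r = r ∷ []

  eval : Carrier → Poly → Carrier
  eval r []      = 0#
  eval r (x ∷ f) = x + r * eval r f

  coeff-+ : ∀ f g n → coeff (f +ₚ g) n ≈ coeff f n + coeff g n
  coeff-+ []      g       n       = sym (+-identityˡ _)
  coeff-+ (x ∷ f) []      n       = sym (+-identityʳ _)
  coeff-+ (x ∷ f) (y ∷ g) zero    = refl
  coeff-+ (x ∷ f) (y ∷ g) (suc n) = coeff-+ f g n

  coeff-neg : ∀ f n → coeff (-ₚ f) n ≈ - coeff f n
  coeff-neg []      n       = sym -0#≈0#
  coeff-neg (x ∷ f) zero    = refl
  coeff-neg (x ∷ f) (suc n) = coeff-neg f n

  coeff-∙ : ∀ r f n → coeff (r ∙ f) n ≈ r * coeff f n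
  coeff-∙ r []      n       = sym (zeroʳ r)
  coeff-∙ r (x ∷ f) zero    = refl
  coeff-∙ r (x ∷ f) (suc n) = coeff-∙ r f n

  ≈ₚ-refl : ∀ {f} → f ≈ₚ f
  ≈ₚ-refl = coeffwise λ n → refl

  ≈ₚ-sym : ∀ {f g} → f ≈ₚ g → g ≈ₚ f
  ≈ₚ-sym e = coeffwise λ n → sym (at e n)

  ≈ₚ-trans : ∀ {f g h} → f ≈ₚ g → g ≈ₚ h → f ≈ₚ h
  ≈ₚ-trans e e′ = coeffwise λ n → trans (at e n) (at e′ n)

  ∷-cong : ∀ {x y f g} → x ≈ y → f ≈ₚ g → (x ∷ f) ≈ₚ (y ∷ g)
  ∷-cong e e′ = coeffwise λ { zero → e ; (suc n) → at e′ n }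

  0∷[] : (0# ∷ []) ≈ₚ []
  0∷[] = coeffwise λ { zero → refl ; (suc n) → refl }

  +ₚ-cong : ∀ {f f′ g g′} → f ≈ₚ f′ → g ≈ₚ g′ → f +ₚ g ≈ₚ f′ +ₚ g′
  +ₚ-cong {f} {f′} {g} {g′} e e′ = coeffwise λ n →
    trans (coeff-+ f g n) (trans (+-cong (at e n) (at e′ n)) (sym (coeff-+ f′ g′ n)))

  +ₚ-assoc : ∀ f g h → (f +ₚ g) +ₚ h ≈ₚ f +ₚ (g +ₚ h)
  +ₚ-assoc f g h = coeffwise λ n →
    trans (trans (coeff-+ (f +ₚ g) h n) (+-congʳ (coeff-+ f g n)))
      (trans (+-assoc _ _ _)
        (sym (trans (coeff-+ f (g +ₚ h) n) (+-congˡ (coeff-+ g h n)))))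

  +ₚ-comm : ∀ f g → f +ₚ g ≈ₚ g +ₚ f
  +ₚ-comm f g = coeffwise λ n →
    trans (coeff-+ f g n) (trans (+-comm _ _) (sym (coeff-+ g f n)))

  +ₚ-identityʳ : ∀ f → f +ₚ [] ≈ₚ f
  +ₚ-identityʳ f = +ₚ-comm f []

  +ₚ-inverseˡ : ∀ f → (-ₚ f) +ₚ f ≈ₚ []
  +ₚ-inverseˡ f = coeffwise λ n →
    trans (coeff-+ (-ₚ f) f n) (trans (+-congʳ (coeff-neg f n)) (-‿inverseˡ _))

  -ₚ-cong : ∀ {f g} → f ≈ₚ g → -ₚ f ≈ₚ -ₚ g
  -ₚ-cong {f} {g} e = coeffwise λ n →
    trans (coeff-neg f n) (trans (-‿cong (at e n)) (sym (coeff-neg g n)))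

  +ₚ-interchange : ∀ f g h k → (f +ₚ g) +ₚ (h +ₚ k) ≈ₚ (f +ₚ h) +ₚ (g +ₚ k)
  +ₚ-interchange f g h k = coeffwise λ n →
    trans (trans (coeff-+ (f +ₚ g) (h +ₚ k) n) (+-cong (coeff-+ f g n) (coeff-+ h k n)))
      (trans (interchange _ _ _ _)
        (sym (trans (coeff-+ (f +ₚ h) (g +ₚ k) n) (+-cong (coeff-+ f h n) (coeff-+ g k n)))))

  ∙-cong : ∀ {r s f g} → r ≈ s → f ≈ₚ g → r ∙ f ≈ₚ s ∙ g
  ∙-cong {r} {s} {f} {g} e e′ = coeffwise λ n →
    trans (coeff-∙ r f n) (trans (*-cong e (at e′ n)) (sym (coeff-∙ s g n)))

  ∙-zeroˡ : ∀ {r} f → r ≈ 0# → r ∙ f ≈ₚ []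
  ∙-zeroˡ {r} f e = coeffwise λ n →
    trans (coeff-∙ r f n) (trans (*-congʳ e) (zeroˡ _))

  ∙-identityˡ : ∀ f → 1# ∙ f ≈ₚ f
  ∙-identityˡ f = coeffwise λ n → trans (coeff-∙ 1# f n) (*-identityˡ _)

  ∙-distribˡ : ∀ r f g → r ∙ (f +ₚ g) ≈ₚ r ∙ f +ₚ r ∙ g
  ∙-distribˡ r f g = coeffwise λ n →
    trans (trans (coeff-∙ r (f +ₚ g) n) (*-congˡ (coeff-+ f g n)))
      (trans (distribˡ _ _ _)
        (sym (trans (coeff-+ (r ∙ f) (r ∙ g) n) (+-cong (coeff-∙ r f n) (coeff-∙ r g n)))))

  ∙-distribʳ : ∀ r s f → (r + s) ∙ f ≈ₚ r ∙ f +ₚ s ∙ f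
  ∙-distribʳ r s f = coeffwise λ n →
    trans (coeff-∙ (r + s) f n)
      (trans (distribʳ _ _ _)
        (sym (trans (coeff-+ (r ∙ f) (s ∙ f) n) (+-cong (coeff-∙ r f n) (coeff-∙ s f n)))))

  ∙-assoc : ∀ r s f → (r * s) ∙ f ≈ₚ r ∙ s ∙ f
  ∙-assoc r s f = coeffwise λ n →
    trans (coeff-∙ (r * s) f n)
      (trans (*-assoc _ _ _)
        (sym (trans (coeff-∙ r (s ∙ f) n) (*-congˡ (coeff-∙ s f n)))))

  ∙-shift : ∀ r f → r ∙ (0# ∷ f) ≈ₚ 0# ∷ r ∙ f
  ∙-shift r f = ∷-cong (zeroʳ r) ≈ₚ-refl

  +-shift : ∀ f g → (0# ∷ f) +ₚ (0# ∷ g) ≈ₚ 0# ∷ (f +ₚ g)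
  +-shift f g = ∷-cong (+-identityˡ 0#) ≈ₚ-refl

  tail-≈ₚ : ∀ {x y f g} → (x ∷ f) ≈ₚ (y ∷ g) → f ≈ₚ g
  tail-≈ₚ e = coeffwise λ n → at e (suc n)

  *ₚ-zeroˡ : ∀ f g → f ≈ₚ [] → f *ₚ g ≈ₚ []
  *ₚ-zeroˡ []      g e = ≈ₚ-refl
  *ₚ-zeroˡ (x ∷ f) g e =
    ≈ₚ-trans (+ₚ-cong (∙-zeroˡ g (at e 0)) (∷-cong refl (*ₚ-zeroˡ f g (coeffwise λ n → at e (suc n))))) 0∷[]

  *ₚ-zeroʳ : ∀ f → f *ₚ [] ≈ₚ []
  *ₚ-zeroʳ []      = ≈ₚ-refl
  *ₚ-zeroʳ (x ∷ f) = ≈ₚ-trans (∷-cong refl (*ₚ-zeroʳ f)) 0∷[]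

  *ₚ-congʳ : ∀ f f′ g → f ≈ₚ f′ → f *ₚ g ≈ₚ f′ *ₚ g
  *ₚ-congʳ []      f′       g e = ≈ₚ-sym (*ₚ-zeroˡ f′ g (≈ₚ-sym e))
  *ₚ-congʳ (x ∷ f) []       g e = *ₚ-zeroˡ (x ∷ f) g e
  *ₚ-congʳ (x ∷ f) (y ∷ f′) g e =
    +ₚ-cong (∙-cong (at e 0) ≈ₚ-refl) (∷-cong refl (*ₚ-congʳ f f′ g (tail-≈ₚ e)))

  *ₚ-congˡ : ∀ f {g g′} → g ≈ₚ g′ → f *ₚ g ≈ₚ f *ₚ g′
  *ₚ-congˡ []      e = ≈ₚ-refl
  *ₚ-congˡ (x ∷ f) e = +ₚ-cong (∙-cong refl e) (∷-cong refl (*ₚ-congˡ f e))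

  *ₚ-distribʳ : ∀ h f g → (f +ₚ g) *ₚ h ≈ₚ f *ₚ h +ₚ g *ₚ h
  *ₚ-distribʳ h []      g       = ≈ₚ-refl
  *ₚ-distribʳ h (x ∷ f) []      = ≈ₚ-sym (+ₚ-identityʳ _)
  *ₚ-distribʳ h (x ∷ f) (y ∷ g) =
    ≈ₚ-trans
      (+ₚ-cong (∙-distribʳ x y h)
        (≈ₚ-trans (∷-cong refl (*ₚ-distribʳ h f g)) (≈ₚ-sym (+-shift (f *ₚ h) (g *ₚ h)))))
      (+ₚ-interchange (x ∙ h) (y ∙ h) (0# ∷ f *ₚ h) (0# ∷ g *ₚ h))

  *ₚ-shift : ∀ f g → (0# ∷ f) *ₚ g ≈ₚ 0# ∷ f *ₚ g
  *ₚ-shift f g = +ₚ-cong (∙-zeroˡ g refl) ≈ₚ-refl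

  ∙-*ₚ : ∀ r f g → (r ∙ f) *ₚ g ≈ₚ r ∙ (f *ₚ g)
  ∙-*ₚ r []      g = ≈ₚ-refl
  ∙-*ₚ r (x ∷ f) g =
    ≈ₚ-trans
      (+ₚ-cong (∙-assoc r x g)
        (≈ₚ-trans (∷-cong refl (∙-*ₚ r f g)) (≈ₚ-sym (∙-shift r (f *ₚ g)))))
      (≈ₚ-sym (∙-distribˡ r (x ∙ g) (0# ∷ f *ₚ g)))

  *ₚ-assoc : ∀ f g h → (f *ₚ g) *ₚ h ≈ₚ f *ₚ (g *ₚ h)
  *ₚ-assoc []      g h = ≈ₚ-refl
  *ₚ-assoc (x ∷ f) g h =
    ≈ₚ-trans (*ₚ-distribʳ h (x ∙ g) (0# ∷ f *ₚ g))
      (+ₚ-cong (∙-*ₚ x g h)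
        (≈ₚ-trans (*ₚ-shift (f *ₚ g) h) (∷-cong refl (*ₚ-assoc f g h))))

  *ₚ-∷ : ∀ f y g → f *ₚ (y ∷ g) ≈ₚ y ∙ f +ₚ (0# ∷ f *ₚ g)
  *ₚ-∷ []      y g = ≈ₚ-sym 0∷[]
  *ₚ-∷ (x ∷ f) y g = ∷-cong (+-congʳ (*-comm x y))
    (≈ₚ-trans (+ₚ-cong ≈ₚ-refl (*ₚ-∷ f y g))
      (≈ₚ-trans (≈ₚ-sym (+ₚ-assoc (x ∙ g) (y ∙ f) (0# ∷ f *ₚ g)))
        (≈ₚ-trans (+ₚ-cong (+ₚ-comm (x ∙ g) (y ∙ f)) ≈ₚ-refl)
          (+ₚ-assoc (y ∙ f) (x ∙ g) (0# ∷ f *ₚ g)))))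

  *ₚ-comm : ∀ f g → f *ₚ g ≈ₚ g *ₚ f
  *ₚ-comm []      g = ≈ₚ-sym (*ₚ-zeroʳ g)
  *ₚ-comm (x ∷ f) g =
    ≈ₚ-trans (+ₚ-cong ≈ₚ-refl (∷-cong refl (*ₚ-comm f g))) (≈ₚ-sym (*ₚ-∷ g x f))

  *ₚ-identityˡ : ∀ f → 1ₚ *ₚ f ≈ₚ f
  *ₚ-identityˡ f = ≈ₚ-trans (+ₚ-cong (∙-identityˡ f) 0∷[]) (+ₚ-identityʳ f)

  ∷-expand : ∀ x f → (x ∷ f) ≈ₚ C x +ₚ X *ₚ f
  ∷-expand x f = ≈ₚ-sym (≈ₚ-trans
    (+ₚ-cong {C x} ≈ₚ-refl (≈ₚ-trans (*ₚ-shift 1ₚ f) (∷-cong refl (*ₚ-identityˡ f))))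
    (∷-cong (+-identityʳ x) ≈ₚ-refl))

  *ₚ-cong : ∀ {f f′ g g′} → f ≈ₚ f′ → g ≈ₚ g′ → f *ₚ g ≈ₚ f′ *ₚ g′
  *ₚ-cong {f} {f′} {g} {g′} e e′ = ≈ₚ-trans (*ₚ-congʳ f f′ g e) (*ₚ-congˡ f′ e′)

  isCommutativeRingₚ : IsCommutativeRing _≈ₚ_ _+ₚ_ _*ₚ_ -ₚ_ 0ₚ 1ₚ
  isCommutativeRingₚ = record
    { isRing = record
      { +-isAbelianGroup = record
        { isGroup = record
          { isMonoid = record
            { isSemigroup = record
              { isMagma = record
                { isEquivalence = record { refl = ≈ₚ-refl ; sym = ≈ₚ-sym ; trans = ≈ₚ-trans }
                ; ∙-cong = +ₚ-cong
                }
              ; assoc = +ₚ-assoc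
              }
            ; identity = (λ f → ≈ₚ-refl) , +ₚ-identityʳ
            }
          ; inverse = +ₚ-inverseˡ , λ f → ≈ₚ-trans (+ₚ-comm f (-ₚ f)) (+ₚ-inverseˡ f)
          ; ⁻¹-cong = -ₚ-cong
          }
        ; comm = +ₚ-comm
        }
      ; *-cong = *ₚ-cong
      ; *-assoc = *ₚ-assoc
      ; *-identity = *ₚ-identityˡ , λ f → ≈ₚ-trans (*ₚ-comm f 1ₚ) (*ₚ-identityˡ f)
      ; distrib = (λ h f g → ≈ₚ-trans (*ₚ-comm h (f +ₚ g))
                      (≈ₚ-trans (*ₚ-distribʳ h f g) (+ₚ-cong (*ₚ-comm f h) (*ₚ-comm g h))))
                , *ₚ-distribʳ
      }
    ; *-comm = *ₚ-comm
    }

  polynomialRing : CommutativeRing c ℓ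
  polynomialRing = record { isCommutativeRing = isCommutativeRingₚ }

  MonicOfDegree : ℕ → Poly → Set ℓ
  MonicOfDegree d f = (coeff f d ≈ 1#) × (∀ n → d < n → coeff f n ≈ 0#)

-- R[x⁻¹] is modelled as R[u] with u = x⁻¹.
module InverseVariable (R : CommutativeRing c ℓ) where
  open CommutativeRing R
  open Mult +-monoid renaming (_×_ to _·_)
  open Polynomial R

  -- value at x = 1, that is, at u = 1
  atOne : Poly → Carrier
  atOne = eval 1#

  negDegreeScale : ℕ → Poly → Poly
  negDegreeScale d []      = []
  negDegreeScale d (r ∷ f) = (- (d · r)) ∷ negDegreeScale (suc d) f

  -- ∂/∂x (r x⁻ᵈ) = - d r x⁻ᵈ⁻¹
  ∂/∂x : Poly → Poly
  ∂/∂x f = 0# ∷ negDegreeScale 0 f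

module ListSum (R : CommutativeRing c ℓ) where
  open CommutativeRing R
  open CommutativeSemigroupProperties +-commutativeSemigroup using (interchange)

  ∑ : {A : Set a} → List A → (A → Carrier) → Carrier
  ∑ xs f = foldr (λ x s → f x + s) 0# xs

  module _ {A : Set a} where
    ∑-cong : ∀ (xs : List A) {f g} → (∀ x → f x ≈ g x) → ∑ xs f ≈ ∑ xs g
    ∑-cong []       e = refl
    ∑-cong (x ∷ xs) e = +-cong (e x) (∑-cong xs e)

    ∑-+ : ∀ (xs : List A) f g → ∑ xs (λ x → f x + g x) ≈ ∑ xs f + ∑ xs g
    ∑-+ []       f g = sym (+-identityˡ 0#)
    ∑-+ (x ∷ xs) f g = trans (+-congˡ (∑-+ xs f g)) (interchange _ _ _ _)

    ∑-*ˡ : ∀ (xs : List A) r f → ∑ xs (λ x → r * f x) ≈ r * ∑ xs f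
    ∑-*ˡ []       r f = sym (zeroʳ r)
    ∑-*ˡ (x ∷ xs) r f = trans (+-congˡ (∑-*ˡ xs r f)) (sym (distribˡ _ _ _))

    ∑-++ : ∀ (xs ys : List A) f → ∑ (xs ++ ys) f ≈ ∑ xs f + ∑ ys f
    ∑-++ []       ys f = sym (+-identityˡ _)
    ∑-++ (x ∷ xs) ys f = trans (+-congˡ (∑-++ xs ys f)) (sym (+-assoc _ _ _))

  ∑-map : ∀ {b} {A : Set a} {B : Set b} (h : A → B) (xs : List A) f → ∑ (map h xs) f ≈ ∑ xs (f ∘ h)
  ∑-map h []       f = refl
  ∑-map h (x ∷ xs) f = +-congˡ (∑-map h xs f)

  ∑-concatMap : ∀ {b} {A : Set a} {B : Set b} (h : A → List B) (xs : List A) f →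
                ∑ (concatMap h xs) f ≈ ∑ xs (λ x → ∑ (h x) f)
  ∑-concatMap h []       f = refl
  ∑-concatMap h (x ∷ xs) f = trans (∑-++ (h x) (concatMap h xs) f) (+-congˡ (∑-concatMap h xs f))

-- The list of c₀ + c₁X + ⋯ + X^d with all cᵢ taken from E.
monicsFrom : {K : Set a} → K → List K → ℕ → List (List K)
monicsFrom one E zero    = (one ∷ []) ∷ []
monicsFrom one E (suc d) = concatMap (λ x → map (x ∷_) (monicsFrom one E d)) E

-- A product of n factors affine in the coefficients, n < d, sums to zero over
-- the monic polynomials of degree d: fixing c₀ = x, the product differs from
-- its value at c₀ = 0 by products of n - 1 such factors, and the value at
-- c₀ = 0, being independent of x, is killed by the sum over x ∈ E.
module Vanishing (R : CommutativeRing c ℓ) {K : Set a} (one : K) (E : List K)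
  (E-kills : ∀ r → CommutativeRing._≈_ R (ListSum.∑ R E (λ _ → r)) (CommutativeRing.0# R))
  {I : Set} (ι : K → CommutativeRing.Carrier R)
  (s : I → CommutativeRing.Carrier R) (ev : I → List K → CommutativeRing.Carrier R)
  (ev-∷ : ∀ i x b → CommutativeRing._≈_ R (ev i (x ∷ b))
                      (CommutativeRing._+_ R (ι x) (CommutativeRing._*_ R (s i) (ev i b)))) where

  open CommutativeRing R
  open ListSum R

  private
    open CommutativeSemigroupProperties *-commutativeSemigroup using () renaming (x∙yz≈y∙xz to *-swap)

    Factor : Set _
    Factor = Carrier × Carrier × I

    value : Factor → List K → Carrier
    value (u , v , i) b = u + v * ev i b

    prod : List Factor → List K → Carrier
    prod []       b = 1#
    prod (φ ∷ Φ) b = value φ b * prod Φ b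

    prod-++ : ∀ Φ Ψ b → prod (Φ ++ Ψ) b ≈ prod Φ b * prod Ψ b
    prod-++ []       Ψ b = sym (*-identityˡ _)
    prod-++ (φ ∷ Φ) Ψ b = trans (*-congˡ (prod-++ Φ Ψ b)) (sym (*-assoc _ _ _))

    at-x at-0 : K → Factor → Factor
    at-x x (u , v , i) = u + v * ι x , v * s i , i
    at-0 x (u , v , i) = u , v * s i , i

    value-∷ : ∀ x φ b → value φ (x ∷ b) ≈ value (at-x x φ) b
    value-∷ x (u , v , i) b =
      trans (+-congˡ (trans (*-congˡ (ev-∷ i x b)) (distribˡ _ _ _)))
        (trans (sym (+-assoc _ _ _)) (+-congˡ (sym (*-assoc _ _ _))))

    prod-∷ : ∀ x Φ b → prod Φ (x ∷ b) ≈ prod (map (at-x x) Φ) b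
    prod-∷ x []       b = refl
    prod-∷ x (φ ∷ Φ) b = *-cong (value-∷ x φ b) (prod-∷ x Φ b)

    M : ℕ → List (List K)
    M = monicsFrom one E

    split : ∀ x φ P b r → P * (value (at-x x φ) b * r) ≈ (value (at-0 x φ) b * P) * r + (proj₁ (proj₂ φ) * ι x) * (P * r)
    split x (u , v , i) P b r =
      trans (*-congˡ (trans (*-congʳ (trans (+-assoc _ _ _) (trans (+-congˡ (+-comm _ _)) (sym (+-assoc _ _ _))))) (distribʳ _ _ _)))
        (trans (distribˡ _ _ _) (+-cong (trans (*-swap _ _ _) (sym (*-assoc _ _ _))) (*-swap _ _ _)))

    Vanishes : ℕ → Set _
    Vanishes d = ∀ Φ → length Φ < d → ∑ (M d) (prod Φ) ≈ 0#

    telescope : ∀ d → Vanishes d → ∀ x Ψ Φ → length Ψ ℕ.+ length Φ ≤ d →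
      ∑ (M d) (λ b → prod Ψ b * prod (map (at-x x) Φ) b) ≈ ∑ (M d) (λ b → prod Ψ b * prod (map (at-0 x) Φ) b)
    telescope d ih x Ψ [] le = refl
    telescope d ih x Ψ (φ ∷ Φ) le =
      trans (∑-cong (M d) (λ b → split x φ (prod Ψ b) b (prod Φx b)))
      (trans (∑-+ (M d) _ _)
      (trans (+-cong (telescope d ih x (at-0 x φ ∷ Ψ) Φ lt)
                     (trans (∑-*ˡ (M d) _ _)
                       (trans (*-congˡ (trans (∑-cong (M d) (λ b → sym (prod-++ Ψ Φx b))) (ih (Ψ ++ Φx) lt′)))
                         (zeroʳ _))))
      (trans (+-identityʳ _)
        (∑-cong (M d) (λ b → trans (*-assoc _ _ _) (*-swap _ _ _))))))
      where
      Φx = map (at-x x) Φ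
      lt : suc (length Ψ ℕ.+ length Φ) ≤ d
      lt = ≡.subst (_≤ d) (ℕ.+-suc (length Ψ) (length Φ)) le
      lt′ : length (Ψ ++ Φx) < d
      lt′ = ≡.subst (_< d) (≡.sym (≡.trans (length-++ Ψ) (≡.cong (length Ψ ℕ.+_) (length-map (at-x x) Φ)))) lt

    vanishes : ∀ d → Vanishes d
    vanishes (suc d) Φ (s≤s le) =
      trans (∑-concatMap (λ x → map (x ∷_) (M d)) E (prod Φ))
      (trans (∑-cong E (λ x →
          trans (∑-map (x ∷_) (M d) (prod Φ))
          (trans (∑-cong (M d) (λ b → trans (prod-∷ x Φ b) (sym (*-identityˡ _))))
          (trans (telescope d (vanishes d) x [] Φ le)
                 (∑-cong (M d) (λ b → trans (*-identityˡ _) (at-0-indep x b Φ)))))))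
        (E-kills (∑ (M d) (λ b → prod₀ Φ b))))
      where
      prod₀ : List Factor → List K → Carrier
      prod₀ []                b = 1#
      prod₀ ((u , v , i) ∷ Φ) b = (u + v * s i * ev i b) * prod₀ Φ b
      at-0-indep : ∀ x b Φ → prod (map (at-0 x) Φ) b ≈ prod₀ Φ b
      at-0-indep x b []      = refl
      at-0-indep x b (φ ∷ Φ) = *-congˡ (at-0-indep x b Φ)

  open Exp semiring using (_^_)

  private
    pure : I → Factor
    pure i = 0# , 1# , i

    prod-replicate : ∀ n i b → prod (replicate n (pure i)) b ≈ ev i b ^ n
    prod-replicate zero    i b = refl
    prod-replicate (suc n) i b =
      *-cong (trans (+-identityˡ _) (*-identityˡ _)) (prod-replicate n i b)

  powerSum-vanishes : ∀ i j m n d → m ℕ.+ n < d → ∑ (monicsFrom one E d) (λ b → ev i b ^ m * ev j b ^ n) ≈ 0#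
  powerSum-vanishes i j m n d lt =
    trans (∑-cong (M d) (λ b → sym (trans (prod-++ Φ Ψ b) (*-cong (prod-replicate m i b) (prod-replicate n j b)))))
      (vanishes d (Φ ++ Ψ) (≡.subst (_< d) (≡.sym len) lt))
    where
    Φ Ψ : List Factor
    Φ = replicate m (pure i)
    Ψ = replicate n (pure j)
    len : length (Φ ++ Ψ) ≡ m ℕ.+ n
    len = ≡.trans (length-++ Φ) (≡.cong₂ ℕ._+_ (length-replicate m) (length-replicate n))

module Pellarin {q : ℕ} (𝔽 : FiniteField c ℓ q) where
  open FiniteField 𝔽 public using () renaming (commutativeRing to 𝔽q)
  open FiniteField 𝔽 using (cardinality)
  private
    module F = CommutativeRing 𝔽q
    module Fθ = Polynomial 𝔽q

  -- A = 𝔽q[θ]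
  A : CommutativeRing c ℓ
  A = Fθ.polynomialRing
  private
    module A = CommutativeRing A
    module PA = Polynomial A

  A[t] : CommutativeRing c ℓ
  A[t] = PA.polynomialRing
  private
    module P = Polynomial A[t]
  open CommutativeRing A[t]
  open Exp semiring using (_^_)
  open ListSum A[t]

  A[t][x⁻¹] : CommutativeRing c ℓ
  A[t][x⁻¹] = P.polynomialRing

  elements : List F.Carrier
  elements = tabulate (Inverse.to cardinality)

  A₊ : ℕ → List A.Carrier
  A₊ = monicsFrom F.1# elements

  elements-complete : ∀ x → Any (x F.≈_) elements
  elements-complete x = AnyP.tabulate⁺ (Inverse.from cardinality x)
    (F.sym (Inverse.strictlyInverseˡ cardinality x))

  elements-unique : AllPairs (λ x y → ¬ (x F.≈ y)) elements
  elements-unique = AllPairsP.tabulate⁺ λ {i} {j} i≢j e → i≢j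
    (≡.trans (≡.sym (Inverse.strictlyInverseʳ cardinality i))
      (≡.trans (Inverse.from-cong cardinality e) (Inverse.strictlyInverseʳ cardinality j)))

  -- A₊ d enumerates the monic polynomials of degree d, each exactly once.
  A₊-sound : ∀ d → All (Fθ.MonicOfDegree d) (A₊ d)
  A₊-sound zero    = (F.refl , λ { (suc n) _ → F.refl }) ∷ []
  A₊-sound (suc d) = AllP.concat⁺ (AllP.map⁺ (All.universal (λ x →
    AllP.map⁺ (All.map (λ { (e , z) → e , λ { (suc n) (s≤s lt) → z n lt } }) (A₊-sound d))) elements))

  A₊-complete : ∀ d a → Fθ.MonicOfDegree d a → Any (a A.≈_) (A₊ d)
  A₊-complete zero a (e , z) = here (Fθ.coeffwise λ { zero → e ; (suc n) → z (suc n) (s≤s z≤n) })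
  A₊-complete (suc d) [] (e , z) =
    ⊥-elim (FiniteField.1≉0 𝔽 (F.sym e))
  A₊-complete (suc d) (x ∷ a) (e , z) =
    AnyP.concat⁺ (AnyP.map⁺ (Any.map (λ x≈y → AnyP.map⁺ (Any.map (Fθ.∷-cong x≈y)
      (A₊-complete d a (e , λ n lt → z (suc n) (s≤s lt))))) (elements-complete x)))

  A₊-unique : ∀ d → AllPairs (λ a b → ¬ (a A.≈ b)) (A₊ d)
  A₊-unique zero    = [] ∷ []
  A₊-unique (suc d) = AllPairsP.concat⁺
    (AllP.map⁺ (All.universal (λ x → AllPairsP.map⁺ (AllPairs.map (λ ne e → ne (Fθ.tail-≈ₚ e)) (A₊-unique d))) elements))
    (AllPairsP.map⁺ (AllPairs.map (λ ne → AllP.map⁺ (All.universal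
      (λ a → AllP.map⁺ (All.universal (λ b e → ne (Fθ.at e 0)) (A₊ d))) (A₊ d))) elements-unique))

  -- χₜ followed by the inclusion 𝔽q[t] ⊆ A[t]: the coefficients of θⁱ become
  -- constants of A and serve as the coefficients of tⁱ.
  χₜ : A.Carrier → Carrier
  χₜ = map Fθ.C

  const : A.Carrier → Carrier
  const = PA.C

  -- S_d(χₜ^β, k)
  S : ℕ → ℕ → ℕ → Carrier
  S d β k = ∑ (A₊ d) λ a → χₜ a ^ β * const a ^ k

  ι : F.Carrier → Carrier
  ι x = const (Fθ.C x)

  ι-cong : ∀ {x y} → x F.≈ y → ι x ≈ ι y
  ι-cong e = PA.∷-cong (Fθ.∷-cong e Fθ.≈ₚ-refl) PA.≈ₚ-refl

  open Sum +-commutativeMonoid using (sum; sum-cong-≋; ∑-distrib-+; sum-permute)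
  open RingProperties ring using (+-cancelˡ)
  open Inverse cardinality using (to; from; from-cong; strictlyInverseˡ; strictlyInverseʳ)

  shift : Permutation q q
  shift = permutation (λ i → from (to i F.+ F.1#)) (λ i → from (to i F.- F.1#))
    (λ i → ≡.trans (from-cong (F.trans (F.+-congʳ (strictlyInverseˡ _))
             (F.trans (F.+-assoc _ _ _) (F.trans (F.+-congˡ (F.-‿inverseˡ _)) (F.+-identityʳ _)))))
             (strictlyInverseʳ i))
    (λ i → ≡.trans (from-cong (F.trans (F.+-congʳ (strictlyInverseˡ _))
             (F.trans (F.+-assoc _ _ _) (F.trans (F.+-congˡ (F.-‿inverseʳ _)) (F.+-identityʳ _)))))
             (strictlyInverseʳ i))

  -- translating the summation variable of ∑_x ι x by 1 shows q · 1 = 0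
  sum-one : sum {q} (λ _ → ι F.1#) ≈ 0#
  sum-one = +-cancelˡ (sum (ι ∘ to)) _ _
    (trans (sym (∑-distrib-+ (ι ∘ to) (λ _ → ι F.1#)))
      (trans (sum-cong-≋ (λ i → ι-cong (F.sym (strictlyInverseˡ (to i F.+ F.1#)))))
        (trans (sym (sum-permute (ι ∘ to) shift)) (sym (+-identityʳ _)))))

  ∑-tabulate : ∀ {n} (g : Fin n → F.Carrier) (r : Carrier) → ∑ (tabulate g) (λ _ → r) ≈ sum {n} (λ _ → r)
  ∑-tabulate {zero}  g r = refl
  ∑-tabulate {suc n} g r = +-congˡ (∑-tabulate (g ∘ suc) r)

  elements-kill : ∀ r → ∑ elements (λ _ → r) ≈ 0#
  elements-kill r =
    trans (∑-cong elements (λ _ → sym (*-identityʳ r)))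
      (trans (∑-*ˡ elements r (λ _ → 1#))
        (trans (*-congˡ {r} (trans (∑-tabulate to 1#) sum-one)) (zeroʳ r)))

  variables : Bool → Carrier
  variables true  = PA.X
  variables false = const Fθ.X

  embed : Bool → A.Carrier → Carrier
  embed true  = χₜ
  embed false = const

  embed-∷ : ∀ i x b → embed i (x ∷ b) ≈ ι x + variables i * embed i b
  embed-∷ true  x b = PA.∷-expand (Fθ.C x) (χₜ b)
  embed-∷ false x b = PA.∷-cong
    (A.trans (Fθ.∷-expand x b) (A.+-congˡ {Fθ.C x} (A.sym (A.+-identityʳ (Fθ.X A.* b))))) PA.≈ₚ-refl

  module V = Vanishing A[t] F.1# elements elements-kill ι variables embed embed-∷

  S-vanishes : ∀ β k → ∃[ N ] (∀ d → N ≤ d → S d β k ≈ 0#)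
  S-vanishes β k = suc (β ℕ.+ k) , λ d lt → V.powerSum-vanishes true false β k d lt

  -- z(χₜ^β, x, -k) = ∑_d S_d(χₜ^β, k) x⁻ᵈ, cut off where all further terms vanish
  z : ℕ → ℕ → CommutativeRing.Carrier A[t][x⁻¹]
  z β k = applyUpTo (λ d → S d β k) (proj₁ (S-vanishes β k))

  coeff-applyUpTo : ∀ N (f : ℕ → Carrier) → (∀ d → N ≤ d → f d ≈ 0#) → ∀ d → P.coeff (applyUpTo f N) d ≈ f d
  coeff-applyUpTo zero    f e d       = sym (e d z≤n)
  coeff-applyUpTo (suc N) f e zero    = refl
  coeff-applyUpTo (suc N) f e (suc d) = coeff-applyUpTo N (f ∘ suc) (λ d′ le → e (suc d′) (s≤s le)) d

  coeff-z : ∀ β k d → P.coeff (z β k) d ≈ S d β k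
  coeff-z β k = coeff-applyUpTo _ _ (proj₂ (S-vanishes β k))

  open InverseVariable A[t] public using (atOne; ∂/∂x)

  -- L(χₜ^β, -k)
  L : ℕ → ℕ → Carrier
  L β k = atOne (z β k)

{-# OPTIONS --safe #-}
-- Write f(a) = χₜ(a)^β a^k, n = β + k, and let T(d) be the sum of f(a) over all
-- a of degree less than d, so that T(0) = f(0) = 0 and T(d) = 0 for d > n.
-- If q - 1 divides n, then f(ya) = yⁿ f(a) = f(a) for y ∈ 𝔽q^×, so the q - 1
-- leading coefficients contribute equally and T(d+1) = T(d) + (q-1) S_d =
-- T(d) - S_d.  Summing over d gives L(χₜ^β, -k) = 0.
--
-- For the two nonvanishing statements specialise to θ = t = 0.  Then S_d becomes
-- the sum of a(0)ⁿ over monic a of degree d, which is 1 for d = 0, the power sum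
-- s = ∑_{y ∈ 𝔽q} yⁿ for d = 1, and 0 for d ≥ 2.  So z(x) becomes 1 + s x⁻¹, where
-- s = -1 if q - 1 divides n and s = 0 otherwise.
module Submission where

open import Defs
open import Algebra.Bundles using (CommutativeMonoid; CommutativeRing)
import Algebra.Properties.CommutativeMonoid.Sum as Sum
import Algebra.Properties.CommutativeSemigroup as CommutativeSemigroupProperties
import Algebra.Properties.CommutativeSemiring.Exp as Exp
import Algebra.Properties.Monoid.Mult as Mult
import Algebra.Properties.Ring as RingProperties
open import Data.Bool using (true; false)
open import Data.Empty using (⊥-elim)
open import Data.Fin using (Fin; zero; suc; punchIn)
open import Data.Fin.Permutation using (Permutation; permutation)
open import Data.Fin.Properties using (_≟_; punchInᵢ≢i)
open import Data.List using (List; []; _∷_; applyUpTo; length; map; tabulate)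
open import Data.List.Properties using (length-tabulate)
open import Data.List.Relation.Unary.All using (All; []; _∷_)
import Data.List.Relation.Unary.All as All
import Data.List.Relation.Unary.All.Properties as AllP
open import Data.List.Relation.Unary.AllPairs using (AllPairs; _∷_)
open import Data.Nat as ℕ using (ℕ; zero; suc; _∸_; _≤_; _<_; z≤n; s≤s)
open import Data.Nat.Divisibility using (_∣_; divides; m%n≡0⇒n∣m)
open import Data.Nat.DivMod using (_%_; _/_; m%n<n; m≡m%n+[m/n]*n)
open import Data.Nat.Primality using (Prime)
import Data.Nat.Properties as ℕ
open import Data.Product using (_×_; _,_)
open import Data.Vec using (Vec; []; _∷_; replicate)
open import Function using (_∘_)
open import Function.Bundles using (Inverse)
open import Level using (Level)
import Relation.Binary.Reasoning.Setoid as SetoidReasoning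
open import Relation.Binary.PropositionalEquality as ≡ using (_≡_; _≢_)
open import Relation.Nullary using (¬_; Dec; yes; no)

private
  variable
    a b c ℓ m ℓm : Level

-- Monoid sums with one exceptional index.

module _ (M : CommutativeMonoid m ℓm) where
  open CommutativeMonoid M
  open Sum M
  open CommutativeSemigroupProperties commutativeSemigroup using (xy∙z≈zy∙x)

  -- Adding `r` on the left replaces dividing by it, so the lemma serves products of field elements
  -- as well as sums in rings.
  sum-constant-except : ∀ {n} (G : Fin n → Carrier) i₀ r → (∀ i → i ≢ i₀ → G i ≈ r) →
    sum G ∙ r ≈ sum {n} (λ _ → r) ∙ G i₀
  sum-constant-except {suc n} G i₀ r e =
    trans (∙-congʳ (trans (sum-remove {i = i₀} G)
                          (∙-congˡ (sum-cong-≋ λ j → e (punchIn i₀ j) (punchInᵢ≢i i₀ j)))))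
          (xy∙z≈zy∙x (G i₀) (sum {n} λ _ → r) r)

-- Finite fields: reindexing by a nonzero factor and Fermat's little theorem.

module FiniteFieldProperties {q : ℕ} (𝔽 : FiniteField c ℓ q) where
  open FiniteField 𝔽
  open CommutativeRing commutativeRing hiding (zero)
  open Exp commutativeSemiring
  open RingProperties ring using (x∙y⁻¹≈ε⇒x≈y)
  open CommutativeSemigroupProperties +-commutativeSemigroup using () renaming (x∙yz≈y∙xz to +-swap)
  open CommutativeSemigroupProperties *-commutativeSemigroup using () renaming (x∙yz≈y∙xz to *-swap)
  open Inverse cardinality using (to; from; to-cong; from-cong; strictlyInverseˡ; strictlyInverseʳ)
  open Pellarin 𝔽 using (elements; elements-unique)
  module ∏ = Sum *-commutativeMonoid
  open SetoidReasoning setoid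

  zero? : ∀ x → Dec (x ≈ 0#)
  zero? x with from x ≟ from 0#
  ... | yes eq = yes (trans (sym (strictlyInverseˡ x)) (trans (to-cong eq) (strictlyInverseˡ 0#)))
  ... | no  ne = no (ne ∘ from-cong)

  *-cancelˡ-nonzero : ∀ {x y w} → ¬ (x ≈ 0#) → x * y ≈ x * w → y ≈ w
  *-cancelˡ-nonzero {x} {y} {w} x≉0 e with inverse x x≉0
  ... | x⁻¹ , xx⁻¹≈1 = trans (sym (undo y)) (trans (*-congˡ e) (undo w))
    where
    undo : ∀ v → x⁻¹ * (x * v) ≈ v
    undo v = trans (sym (*-assoc _ _ _)) (trans (*-congʳ (trans (*-comm _ _) xx⁻¹≈1)) (*-identityˡ v))

  *-nonzero : ∀ {x y} → ¬ (x ≈ 0#) → ¬ (y ≈ 0#) → ¬ (x * y ≈ 0#)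
  *-nonzero x≉0 y≉0 e = y≉0 (*-cancelˡ-nonzero x≉0 (trans e (sym (zeroʳ _))))

  scaling : ∀ y → ¬ (y ≈ 0#) → Permutation q q
  scaling y y≉0 with inverse y y≉0
  ... | w , yw≈1 = permutation (λ i → from (y * to i)) (λ i → from (w * to i))
    (cancels yw≈1) (cancels (trans (*-comm w y) yw≈1))
    where
    cancels : ∀ {u v} → u * v ≈ 1# → ∀ i → from (u * to (from (v * to i))) ≡ i
    cancels uv≈1 i = ≡.trans
      (from-cong (trans (*-congˡ (strictlyInverseˡ _))
        (trans (sym (*-assoc _ _ _)) (trans (*-congʳ uv≈1) (*-identityˡ _)))))
      (strictlyInverseʳ i)

  module _ (M : CommutativeMonoid m ℓm) where
    private module M = CommutativeMonoid M
    open Sum M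

    sum-scale : ∀ y → ¬ (y ≈ 0#) → (g : Carrier → M.Carrier) → (∀ {x x′} → x ≈ x′ → g x M.≈ g x′) →
      sum (λ i → g (to i)) M.≈ sum (λ i → g (y * to i))
    sum-scale y y≉0 g g-cong = M.trans (sum-permute (g ∘ to) (scaling y y≉0))
      (sum-cong-≋ λ i → g-cong (strictlyInverseˡ (y * to i)))

    sum-nonzero-constant : ∀ (g : Carrier → M.Carrier) r → (∀ {x} → x ≈ 0# → g x M.≈ g 0#) →
      (∀ x → ¬ (x ≈ 0#) → g x M.≈ r) →
      sum (λ i → g (to i)) M.∙ r M.≈ sum {q} (λ _ → r) M.∙ g 0#
    sum-nonzero-constant g r g-cong e = M.trans
      (sum-constant-except M (g ∘ to) (from 0#) r λ i i≢ → e (to i) λ toi≈0 →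
        i≢ (≡.trans (≡.sym (strictlyInverseʳ i)) (from-cong toi≈0)))
      (M.∙-congˡ (g-cong (strictlyInverseˡ 0#)))

  private
    -- The value 1 at 0 lets a product over the whole field stand for the product over its nonzero
    -- elements.
    off-zero : Carrier → Carrier → Carrier
    off-zero r x with zero? x
    ... | yes _ = 1#
    ... | no  _ = r

    off-zero-0 : ∀ r {x} → x ≈ 0# → off-zero r x ≈ 1#
    off-zero-0 r {x} e with zero? x
    ... | yes _ = refl
    ... | no ne = ⊥-elim (ne e)

    off-zero-≉0 : ∀ r {x} → ¬ (x ≈ 0#) → off-zero r x ≈ r
    off-zero-≉0 r {x} ne with zero? x
    ... | yes e = ⊥-elim (ne e)
    ... | no _  = refl

    unit : Carrier → Carrier
    unit x = off-zero x x

    unit-cong : ∀ {x y} → x ≈ y → unit x ≈ unit y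
    unit-cong {x} {y} e with zero? x
    ... | yes x≈0 = sym (off-zero-0 y (trans (sym e) x≈0))
    ... | no  x≉0 = trans e (sym (off-zero-≉0 y (x≉0 ∘ trans e)))

    unit-nonzero : ∀ x → ¬ (unit x ≈ 0#)
    unit-nonzero x with zero? x
    ... | yes _  = 1≉0
    ... | no x≉0 = x≉0

    -- At x = 0 both sides are 1; a factor `y` in place of `off-zero y x` would fail there.
    unit-* : ∀ y → ¬ (y ≈ 0#) → ∀ x → unit (y * x) ≈ off-zero y x * unit x
    unit-* y y≉0 x with zero? x
    ... | yes x≈0 = trans (off-zero-0 _ (trans (*-congˡ x≈0) (zeroʳ y))) (sym (*-identityˡ 1#))
    ... | no  x≉0 = off-zero-≉0 _ (*-nonzero y≉0 x≉0)

    product-nonzero : ∀ {n} (f : Fin n → Carrier) → (∀ i → ¬ (f i ≈ 0#)) → ¬ (∏.sum f ≈ 0#)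
    product-nonzero {zero}  f ne = 1≉0
    product-nonzero {suc n} f ne = *-nonzero (ne zero) (product-nonzero (f ∘ suc) (ne ∘ suc))

    -- Multiplication by y permutes the nonzero elements, so their product P
    -- satisfies y^(q-1) P = P.
    product-off-zero : ∀ y → ¬ (y ≈ 0#) → ∏.sum (λ i → off-zero y (to i)) ≈ 1#
    product-off-zero y y≉0 = *-cancelˡ-nonzero (product-nonzero (unit ∘ to) (unit-nonzero ∘ to)) (begin
      P * ∏.sum (λ i → off-zero y (to i))             ≈⟨ *-comm _ _ ⟩
      ∏.sum (λ i → off-zero y (to i)) * P             ≈⟨ sym (∏.∑-distrib-+ (off-zero y ∘ to) (unit ∘ to)) ⟩
      ∏.sum (λ i → off-zero y (to i) * unit (to i))   ≈⟨ ∏.sum-cong-≋ (λ i → sym (unit-* y y≉0 (to i))) ⟩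
      ∏.sum (λ i → unit (y * to i))                   ≈⟨ sym (sum-scale *-commutativeMonoid y y≉0 unit unit-cong) ⟩
      P                                               ≈⟨ sym (*-identityʳ P) ⟩
      P * 1#                                          ∎)
      where P = ∏.sum (unit ∘ to)

  -- The constant product of q factors y differs from the product of `off-zero y`, which is 1, only
  -- in the factor at 0.
  y^q≈y : ∀ y → ¬ (y ≈ 0#) → y ^ q ≈ y
  y^q≈y y y≉0 = begin
    y ^ q                                 ≈⟨ sym (∏.sum-replicate q) ⟩
    ∏.sum {q} (λ _ → y)                   ≈⟨ sym (*-identityʳ _) ⟩
    ∏.sum {q} (λ _ → y) * 1#              ≈⟨ *-congˡ (sym (off-zero-0 y refl)) ⟩
    ∏.sum {q} (λ _ → y) * off-zero y 0#   ≈⟨ sym (sum-nonzero-constant *-commutativeMonoid (off-zero y) y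
                                               (λ e → trans (off-zero-0 y e) (sym (off-zero-0 y refl)))
                                               (λ x → off-zero-≉0 y)) ⟩
    ∏.sum (λ i → off-zero y (to i)) * y   ≈⟨ *-congʳ (product-off-zero y y≉0) ⟩
    1# * y                                ≈⟨ *-identityˡ y ⟩
    y                                     ∎

  q≡suc[q∸1] : q ≡ suc (q ∸ 1)
  q≡suc[q∸1] = inhabited (from 0#)
    where
    inhabited : ∀ {n} → Fin n → n ≡ suc (n ∸ 1)
    inhabited {suc n} _ = ≡.refl

  fermat : ∀ y → ¬ (y ≈ 0#) → y ^ (q ∸ 1) ≈ 1#
  fermat y y≉0 = *-cancelˡ-nonzero y≉0
    (trans (^-congʳ y (≡.sym q≡suc[q∸1])) (trans (y^q≈y y y≉0) (sym (*-identityʳ y))))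

  1^n≈1 : ∀ n → 1# ^ n ≈ 1#
  1^n≈1 zero    = refl
  1^n≈1 (suc n) = trans (*-identityˡ _) (1^n≈1 n)

  ^-multiple : ∀ y → ¬ (y ≈ 0#) → ∀ j → y ^ (j ℕ.* (q ∸ 1)) ≈ 1#
  ^-multiple y y≉0 j = begin
    y ^ (j ℕ.* (q ∸ 1))   ≈⟨ ^-congʳ y (ℕ.*-comm j (q ∸ 1)) ⟩
    y ^ ((q ∸ 1) ℕ.* j)   ≈⟨ sym (^-assocʳ y (q ∸ 1) j) ⟩
    (y ^ (q ∸ 1)) ^ j     ≈⟨ ^-congˡ j (fermat y y≉0) ⟩
    1# ^ j                ≈⟨ 1^n≈1 j ⟩
    1#                    ∎

  -- Root counting, and the exponents n with yⁿ = 1 for all nonzero y.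

  -- The value at x of c₀ + c₁X + ⋯ + X^d, where v = c₀, …, c_{d-1}.
  monic : ∀ {d} → Vec Carrier d → Carrier → Carrier
  monic []      x = 1#
  monic (r ∷ v) x = r + x * monic v x

  private
    x-y+y≈x : ∀ x y → x - y + y ≈ x
    x-y+y≈x x y = trans (+-assoc x (- y) y) (trans (+-congˡ (-‿inverseˡ y)) (+-identityʳ x))

  -- If f = r + X g then (f - f(b)) / (X - b) = g(b) + X (g - g(b)) / (X - b).
  quotient : ∀ {d} → Carrier → Vec Carrier (suc d) → Vec Carrier d
  quotient b (r ∷ [])        = []
  quotient b (r ∷ v@(_ ∷ _)) = monic v b ∷ quotient b v

  -- Division by X - b with remainder. After the induction hypothesis for the tail, writing x = (x -
  -- b) + b in front of its remainder produces the recursion of `quotient`.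
  monic-quotient : ∀ {d} b (v : Vec Carrier (suc d)) x →
    monic v x ≈ (x - b) * monic (quotient b v) x + monic v b
  monic-quotient b (r ∷ []) x = begin
    r + x * 1#                         ≈⟨ +-congˡ (*-congʳ (sym (x-y+y≈x x b))) ⟩
    r + (x - b + b) * 1#               ≈⟨ +-congˡ (distribʳ 1# (x - b) b) ⟩
    r + ((x - b) * 1# + b * 1#)        ≈⟨ +-swap _ _ _ ⟩
    (x - b) * 1# + (r + b * 1#)        ∎
  monic-quotient b (r ∷ v@(_ ∷ _)) x = begin
    r + x * monic v x                              ≈⟨ +-congˡ (*-congˡ (monic-quotient b v x)) ⟩
    r + x * ((x - b) * Q + g)                      ≈⟨ +-congˡ (distribˡ x _ _) ⟩
    r + (x * ((x - b) * Q) + x * g)                ≈⟨ +-congˡ (+-cong (*-swap _ _ _) (*-congʳ (sym (x-y+y≈x x b)))) ⟩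
    r + ((x - b) * (x * Q) + (x - b + b) * g)      ≈⟨ +-congˡ (+-congˡ (distribʳ g (x - b) b)) ⟩
    r + ((x - b) * (x * Q) + ((x - b) * g + b * g)) ≈⟨ +-congˡ (sym (+-assoc _ _ _)) ⟩
    r + ((x - b) * (x * Q) + (x - b) * g + b * g)  ≈⟨ +-swap _ _ _ ⟩
    (x - b) * (x * Q) + (x - b) * g + (r + b * g)  ≈⟨ +-congʳ (trans (sym (distribˡ _ _ _)) (*-congˡ (+-comm _ _))) ⟩
    (x - b) * (g + x * Q) + (r + b * g)            ∎
    where
    Q = monic (quotient b v) x
    g = monic v b

  -- Divide out the first root b. Any other root x satisfies x - b ≠ 0 and so is a root of the
  -- quotient; in degree 0 the polynomial is 1 and has no root.
  roots≤degree : ∀ {d} (v : Vec Carrier d) xs → AllPairs (λ x y → ¬ (x ≈ y)) xs →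
    All (λ x → monic v x ≈ 0#) xs → length xs ≤ d
  roots≤degree v       []       _            _            = z≤n
  roots≤degree []      (b ∷ xs) _            (root ∷ _)   = ⊥-elim (1≉0 root)
  roots≤degree (r ∷ v) (b ∷ xs) (b≉xs ∷ ne) (root ∷ roots) =
    s≤s (roots≤degree (quotient b (r ∷ v)) xs ne (All.zipWith root-of-quotient (b≉xs , roots)))
    where
    root-of-quotient : ∀ {x} → ¬ (b ≈ x) × monic (r ∷ v) x ≈ 0# → monic (quotient b (r ∷ v)) x ≈ 0#
    root-of-quotient {x} (b≉x , rootx) =
      *-cancelˡ-nonzero (λ x-b≈0 → b≉x (sym (x∙y⁻¹≈ε⇒x≈y x b x-b≈0))) (begin
        (x - b) * monic (quotient b (r ∷ v)) x                        ≈⟨ sym (+-identityʳ _) ⟩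
        (x - b) * monic (quotient b (r ∷ v)) x + 0#                   ≈⟨ +-congˡ (sym root) ⟩
        (x - b) * monic (quotient b (r ∷ v)) x + monic (r ∷ v) b      ≈⟨ sym (monic-quotient b (r ∷ v) x) ⟩
        monic (r ∷ v) x                                               ≈⟨ rootx ⟩
        0#                                                            ≈⟨ sym (zeroʳ _) ⟩
        (x - b) * 0#                                                  ∎)

  monic-zeros : ∀ d x → monic (replicate d 0#) x ≈ x ^ d
  monic-zeros zero    x = refl
  monic-zeros (suc d) x = trans (+-identityˡ _) (*-congˡ (monic-zeros d x))

  -- Otherwise X^(r+2) - X, where r + 1 < q - 1, would have q roots.
  ¬all-roots-of-unity : ∀ r → suc r < q ∸ 1 → ¬ (∀ y → ¬ (y ≈ 0#) → y ^ suc r ≈ 1#)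
  ¬all-roots-of-unity r r<q-1 h = ℕ.<⇒≱ r<q-1 (ℕ.≤-pred
    (≡.subst (_≤ suc (suc r)) (≡.trans (length-tabulate to) q≡suc[q∸1])
      (roots≤degree v elements elements-unique (All.universal root elements))))
    where
    v : Vec Carrier (suc (suc r))
    v = 0# ∷ - 1# ∷ replicate r 0#
    root : ∀ x → monic v x ≈ 0#
    root x with zero? x
    ... | yes x≈0 = trans (+-identityˡ _) (trans (*-congʳ x≈0) (zeroˡ _))
    ... | no  x≉0 = begin
      0# + x * (- 1# + x * monic (replicate r 0#) x)   ≈⟨ +-identityˡ _ ⟩
      x * (- 1# + x * monic (replicate r 0#) x)        ≈⟨ *-congˡ (+-congˡ (*-congˡ (monic-zeros r x))) ⟩
      x * (- 1# + x ^ suc r)                           ≈⟨ *-congˡ (+-congˡ (h x x≉0)) ⟩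
      x * (- 1# + 1#)                                  ≈⟨ *-congˡ (-‿inverseˡ 1#) ⟩
      x * 0#                                           ≈⟨ zeroʳ x ⟩
      0#                                               ∎

  instance
    -- If q were 1, then 0 and 1 would coincide. The instance licenses division with remainder by q
    -- - 1.
    q∸1-nonZero : ℕ.NonZero (q ∸ 1)
    q∸1-nonZero = ℕ.≢-nonZero λ q∸1≡0 → 1≉0 (trans (sym (strictlyInverseˡ 1#))
        (trans (to-cong (subsingleton (≡.trans q≡suc[q∸1] (≡.cong suc q∸1≡0)) (from 1#) (from 0#))) (strictlyInverseˡ 0#)))
      where
      subsingleton : ∀ {n} → n ≡ 1 → (i j : Fin n) → i ≡ j
      subsingleton ≡.refl zero zero = ≡.refl

  -- By Fermat, yⁿ depends only on n modulo q - 1, and the root count excludes a nonzero remainder.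
  all-roots-of-unity⇒∣ : ∀ n → (∀ y → ¬ (y ≈ 0#) → y ^ n ≈ 1#) → (q ∸ 1) ∣ n
  all-roots-of-unity⇒∣ n h with n % (q ∸ 1) in eq
  ... | zero  = m%n≡0⇒n∣m n (q ∸ 1) eq
  ... | suc r = ⊥-elim (¬all-roots-of-unity r (≡.subst (_< q ∸ 1) eq (m%n<n n (q ∸ 1))) λ y y≉0 → begin
      y ^ suc r                                 ≈⟨ sym (*-identityʳ _) ⟩
      y ^ suc r * 1#                            ≈⟨ *-congˡ (sym (^-multiple y y≉0 (n / (q ∸ 1)))) ⟩
      y ^ suc r * y ^ (n / (q ∸ 1) ℕ.* (q ∸ 1)) ≈⟨ sym (^-homo-* y (suc r) _) ⟩
      y ^ (suc r ℕ.+ n / (q ∸ 1) ℕ.* (q ∸ 1))   ≈⟨ ^-congʳ y (≡.sym n≡) ⟩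
      y ^ n                                     ≈⟨ h y y≉0 ⟩
      1#                                        ∎)
    where
    n≡ : n ≡ suc r ℕ.+ n / (q ∸ 1) ℕ.* (q ∸ 1)
    n≡ = ≡.trans (m≡m%n+[m/n]*n n (q ∸ 1)) (≡.cong (ℕ._+ n / (q ∸ 1) ℕ.* (q ∸ 1)) eq)

-- Sums and polynomials over a commutative ring.

module _ (R : CommutativeRing c ℓ) where
  open CommutativeRing R hiding (zero)
  open ListSum R
  open Sum +-commutativeMonoid using (sum)

  ∑-zero : {A : Set a} (xs : List A) → ∑ xs (λ _ → 0#) ≈ 0#
  ∑-zero []       = refl
  ∑-zero (x ∷ xs) = trans (+-identityˡ _) (∑-zero xs)

  ∑-swap : {A : Set a} {B : Set b} (xs : List A) (ys : List B) (f : A → B → Carrier) →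
    ∑ xs (λ x → ∑ ys (f x)) ≈ ∑ ys (λ y → ∑ xs (λ x → f x y))
  ∑-swap []       ys f = sym (∑-zero ys)
  ∑-swap (x ∷ xs) ys f = trans (+-congˡ (∑-swap xs ys f)) (sym (∑-+ ys (f x) _))

  ∑-tabulate≈sum : {A : Set a} → ∀ {n} (f : Fin n → A) g → ∑ (tabulate f) g ≈ sum (g ∘ f)
  ∑-tabulate≈sum {n = zero}  f g = refl
  ∑-tabulate≈sum {n = suc n} f g = +-congˡ (∑-tabulate≈sum (f ∘ suc) g)

  open InverseVariable R using (atOne)

  -- Each `s d` is the difference of consecutive values of `T`, so the value at 1 collapses to the
  -- two end values.
  atOne-telescope : ∀ N (T s : ℕ → Carrier) → (∀ d → T (suc d) + s d ≈ T d) →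
    T N + atOne (applyUpTo s N) ≈ T 0
  atOne-telescope zero    T s e = +-identityʳ _
  atOne-telescope (suc N) T s e =
    trans (+-congˡ (trans (+-congˡ (*-identityˡ _)) (+-comm _ _)))
      (trans (sym (+-assoc _ _ _))
        (trans (+-congʳ (atOne-telescope N (T ∘ suc) (s ∘ suc) (e ∘ suc))) (e 0)))

  open Polynomial R

  C-* : ∀ r s → C (r * s) ≈ₚ C r *ₚ C s
  C-* r s = ∷-cong (sym (+-identityʳ (r * s))) ≈ₚ-refl

  coeff₀-* : ∀ f g → coeff (f *ₚ g) 0 ≈ coeff f 0 * coeff g 0
  coeff₀-* []      g = sym (zeroˡ _)
  coeff₀-* (x ∷ f) g = trans (coeff-+ (x ∙ g) (0# ∷ f *ₚ g) 0) (trans (+-identityʳ _) (coeff-∙ x g 0))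

-- Sums over polynomials with a prescribed coefficient of θ^d.

module PellarinProperties {q : ℕ} (𝔽 : FiniteField c ℓ q) where
  open FiniteField 𝔽 using (1≉0; cardinality)
  open Inverse cardinality using (to)
  open Pellarin 𝔽
  open FiniteFieldProperties 𝔽
  private
    module F = CommutativeRing 𝔽q
    module Fθ = Polynomial 𝔽q
    module A = CommutativeRing A
    module PA = Polynomial A
  module ∑F = ListSum 𝔽q
  open Exp F.commutativeSemiring using ()
    renaming (_^_ to _^F_; ^-homo-* to ^F-homo-*; ^-distrib-* to ^F-distrib-*; ^-congˡ to ^F-congˡ; ^-congʳ to ^F-congʳ)
  open CommutativeRing A[t] hiding (zero)
  open Exp commutativeSemiring
  open ListSum A[t]
  open SetoidReasoning setoid

  private
    -- Here `y` is the coefficient of θ^d and may be any field element: `y` = 1 gives `A₊ d`, and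
    -- `y` = 0 gives the polynomials of degree less than d.
    polys : F.Carrier → ℕ → List A.Carrier
    polys y = monicsFrom y elements

  module _ {r ℓr} (R : CommutativeRing r ℓr) where
    private module R = CommutativeRing R
    private module ∑R = ListSum R

    ∑-elements-scale : ∀ y → ¬ (y F.≈ F.0#) → (g : F.Carrier → R.Carrier) →
      (∀ {x x′} → x F.≈ x′ → g x R.≈ g x′) →
      ∑R.∑ elements g R.≈ ∑R.∑ elements (λ x → g (y F.* x))
    ∑-elements-scale y y≉0 g g-cong = R.trans (∑-tabulate≈sum R to g)
      (R.trans (sum-scale R.+-commutativeMonoid y y≉0 g g-cong)
        (R.sym (∑-tabulate≈sum R to (λ x → g (y F.* x)))))

    -- Over the whole field the constant `r` sums to q r = 0, so the q - 1 nonzero elements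
    -- contribute -r.
    ∑-nonzero-constant : (∀ r → ∑R.∑ elements (λ _ → r) R.≈ R.0#) → (g : F.Carrier → R.Carrier) → ∀ r →
      (∀ {x} → x F.≈ F.0# → g x R.≈ g F.0#) → (∀ x → ¬ (x F.≈ F.0#) → g x R.≈ r) →
      ∑R.∑ elements g R.+ r R.≈ g F.0#
    ∑-nonzero-constant kill g r g-cong e = R.trans (R.+-congʳ (∑-tabulate≈sum R to g))
      (R.trans (sum-nonzero-constant R.+-commutativeMonoid g r g-cong e)
        (R.trans (R.+-congʳ (R.trans (R.sym (∑-tabulate≈sum R to (λ _ → r))) (kill r))) (R.+-identityˡ _)))

    ∑-polys-suc : ∀ y d g →
      ∑R.∑ (polys y (suc d)) g R.≈ ∑R.∑ elements (λ x → ∑R.∑ (polys y d) (λ b → g (x ∷ b)))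
    ∑-polys-suc y d g = R.trans (∑R.∑-concatMap (λ x → map (x ∷_) (polys y d)) elements g)
      (∑R.∑-cong elements λ x → ∑R.∑-map (x ∷_) (polys y d) g)

  Congruent : (A.Carrier → Carrier) → Set _
  Congruent g = ∀ {x y} → x A.≈ y → g x ≈ g y

  -- Multiplication by `y` carries top coefficient `w` to `w′` and permutes the choices of every
  -- lower coefficient. Keeping `w′` separate allows values equal to `y` times `w` only up to the
  -- equality of the field.
  ∑-polys-scale : ∀ y → ¬ (y F.≈ F.0#) → ∀ {w w′} → w′ F.≈ y F.* w → ∀ d g → Congruent g →
    ∑ (polys w′ d) g ≈ ∑ (polys w d) (λ b → g (y Fθ.∙ b))
  ∑-polys-scale y y≉0 e zero    g g-cong = +-congʳ (g-cong (Fθ.∷-cong e Fθ.≈ₚ-refl))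
  ∑-polys-scale y y≉0 {w} {w′} e (suc d) g g-cong = begin
    ∑ (polys w′ (suc d)) g
      ≈⟨ ∑-polys-suc A[t] w′ d g ⟩
    ∑ elements (λ x → ∑ (polys w′ d) (λ b → g (x ∷ b)))
      ≈⟨ ∑-cong elements (λ x → ∑-polys-scale y y≉0 e d (λ b → g (x ∷ b)) (λ e → g-cong (Fθ.∷-cong F.refl e))) ⟩
    ∑ elements (λ x → ∑ (polys w d) (λ b → g (x ∷ y Fθ.∙ b)))
      ≈⟨ ∑-elements-scale A[t] y y≉0 _ (λ e → ∑-cong (polys w d) λ b → g-cong (Fθ.∷-cong e Fθ.≈ₚ-refl)) ⟩
    ∑ elements (λ x → ∑ (polys w d) (λ b → g (y Fθ.∙ (x ∷ b))))
      ≈⟨ sym (∑-polys-suc A[t] w d (λ b → g (y Fθ.∙ b))) ⟩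
    ∑ (polys w (suc d)) (λ b → g (y Fθ.∙ b)) ∎

  -- Sorts the polynomials of degree at most d by their coefficient at θ^d. Lists are peeled from
  -- the constant end, so the sum over the top coefficient must be moved past that over the lowest
  -- one.
  ∑-polys-top : ∀ d g → Congruent g → ∑ (polys F.0# (suc d)) g ≈ ∑ elements (λ y → ∑ (polys y d) g)
  ∑-polys-top zero g g-cong = trans (∑-polys-suc A[t] F.0# 0 g)
    -- `x ∷ 0# ∷ []` and `x ∷ []` differ by a trailing zero, which congruence of `g` absorbs.
    (∑-cong elements λ x → +-congʳ (g-cong (Fθ.∷-cong F.refl Fθ.0∷[])))
  ∑-polys-top (suc d) g g-cong = begin
    ∑ (polys F.0# (suc (suc d))) g
      ≈⟨ ∑-polys-suc A[t] F.0# (suc d) g ⟩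
    ∑ elements (λ x → ∑ (polys F.0# (suc d)) (λ b → g (x ∷ b)))
      ≈⟨ ∑-cong elements (λ x → ∑-polys-top d (λ b → g (x ∷ b)) (λ e → g-cong (Fθ.∷-cong F.refl e))) ⟩
    ∑ elements (λ x → ∑ elements (λ y → ∑ (polys y d) (λ b → g (x ∷ b))))
      ≈⟨ ∑-swap A[t] elements elements _ ⟩
    ∑ elements (λ y → ∑ elements (λ x → ∑ (polys y d) (λ b → g (x ∷ b))))
      ≈⟨ ∑-cong elements (λ y → sym (∑-polys-suc A[t] y d g)) ⟩
    ∑ elements (λ y → ∑ (polys y (suc d)) g) ∎

  -- Scaling of the summands by constants, and the vanishing of L.

  coeff-χₜ : ∀ b n → PA.coeff (χₜ b) n A.≈ Fθ.C (Fθ.coeff b n)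
  coeff-χₜ []      n       = Fθ.≈ₚ-sym Fθ.0∷[]
  coeff-χₜ (x ∷ b) zero    = Fθ.≈ₚ-refl
  coeff-χₜ (x ∷ b) (suc n) = coeff-χₜ b n

  embed-cong : ∀ i → Congruent (embed i)
  embed-cong true {x} {y} e = PA.coeffwise λ n → A.trans (coeff-χₜ x n)
    (A.trans (Fθ.∷-cong (Fθ.at e n) Fθ.≈ₚ-refl) (A.sym (coeff-χₜ y n)))
  embed-cong false e = PA.∷-cong e PA.≈ₚ-refl

  embed-[] : ∀ i → embed i [] ≈ 0#
  embed-[] true  = refl
  embed-[] false = PA.0∷[]

  ι-1 : ι F.1# ≈ 1#
  ι-1 = refl

  ι-* : ∀ x y → ι (x F.* y) ≈ ι x * ι y
  ι-* x y = trans (PA.∷-cong (C-* 𝔽q x y) PA.≈ₚ-refl) (C-* A (Fθ.C x) (Fθ.C y))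

  -- The Horner form `embed-∷` gives one induction for both embeddings.
  embed-∙ : ∀ i y b → embed i (y Fθ.∙ b) ≈ ι y * embed i b
  embed-∙ i y []      = trans (embed-[] i) (sym (trans (*-congˡ {ι y} (embed-[] i)) (zeroʳ (ι y))))
  embed-∙ i y (x ∷ b) = begin
    embed i (y F.* x ∷ y Fθ.∙ b)                       ≈⟨ embed-∷ i (y F.* x) (y Fθ.∙ b) ⟩
    ι (y F.* x) + variables i * embed i (y Fθ.∙ b)     ≈⟨ +-cong (ι-* y x) (*-congˡ {variables i} (embed-∙ i y b)) ⟩
    ι y * ι x + variables i * (ι y * embed i b)        ≈⟨ +-congˡ {ι y * ι x} (*-swap (variables i) (ι y) (embed i b)) ⟩
    ι y * ι x + ι y * (variables i * embed i b)        ≈⟨ sym (distribˡ (ι y) (ι x) (variables i * embed i b)) ⟩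
    ι y * (ι x + variables i * embed i b)              ≈⟨ *-congˡ {ι y} (sym (embed-∷ i x b)) ⟩
    ι y * embed i (x ∷ b)                              ∎
    where
    open CommutativeSemigroupProperties *-commutativeSemigroup using () renaming (x∙yz≈y∙xz to *-swap)

  ι-^ : ∀ x n → ι (x ^F n) ≈ ι x ^ n
  ι-^ x zero    = ι-1
  ι-^ x (suc n) = trans (ι-* x (x ^F n)) (*-congˡ {ι x} (ι-^ x n))

  private
    term : ℕ → ℕ → A.Carrier → Carrier
    term β k a = χₜ a ^ β * const a ^ k

  term-cong : ∀ β k → Congruent (term β k)
  term-cong β k e = *-cong (^-congˡ β (embed-cong true e)) (^-congˡ k (embed-cong false e))

  term-∙ : ∀ β k → (q ∸ 1) ∣ (β ℕ.+ k) → ∀ y → ¬ (y F.≈ F.0#) → ∀ b → term β k (y Fθ.∙ b) ≈ term β k b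
  term-∙ β k (divides j β+k≡) y y≉0 b = begin
    χₜ (y Fθ.∙ b) ^ β * const (y Fθ.∙ b) ^ k
      ≈⟨ *-cong (^-congˡ β (embed-∙ true y b)) (^-congˡ k (embed-∙ false y b)) ⟩
    (ι y * χₜ b) ^ β * (ι y * const b) ^ k
      ≈⟨ *-cong (^-distrib-* (ι y) (χₜ b) β) (^-distrib-* (ι y) (const b) k) ⟩
    (ι y ^ β * χₜ b ^ β) * (ι y ^ k * const b ^ k)
      ≈⟨ interchange (ι y ^ β) (χₜ b ^ β) (ι y ^ k) (const b ^ k) ⟩
    (ι y ^ β * ι y ^ k) * term β k b
      ≈⟨ *-congʳ {term β k b} (sym (^-homo-* (ι y) β k)) ⟩
    ι y ^ (β ℕ.+ k) * term β k b
      ≈⟨ *-congʳ {term β k b} (sym (ι-^ y (β ℕ.+ k))) ⟩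
    ι (y ^F (β ℕ.+ k)) * term β k b
      ≈⟨ *-congʳ {term β k b} (ι-cong (F.trans (^F-congʳ y β+k≡) (^-multiple y y≉0 j))) ⟩
    1# * term β k b
      ≈⟨ *-identityˡ (term β k b) ⟩
    term β k b ∎
    where open CommutativeSemigroupProperties *-commutativeSemigroup using (interchange)

  private
    -- With top coefficient 0 at X^d, the list runs over all a of degree less than d.
    T : ℕ → ℕ → ℕ → Carrier
    T β k d = ∑ (polys F.0# d) (term β k)

  -- The vanishing of power sums for top coefficient 0, which makes T(d) zero for d > β + k.
  module V₀ = Vanishing A[t] F.0# elements elements-kill ι variables embed embed-∷

  T-step : ∀ β k → (q ∸ 1) ∣ (β ℕ.+ k) → ∀ d → T β k (suc d) + S d β k ≈ T β k d
  T-step β k div d = trans (+-congʳ {S d β k} (∑-polys-top d (term β k) (term-cong β k)))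
    (∑-nonzero-constant A[t] elements-kill (λ y → ∑ (polys y d) (term β k)) (S d β k)
      (λ {x} x≈0 → trans
        -- Scaling by 1 serves to replace a top coefficient equal to 0 by `F.0#` itself.
        (∑-polys-scale F.1# 1≉0 (F.trans x≈0 (F.sym (F.*-identityˡ F.0#))) d (term β k) (term-cong β k))
        (∑-cong (polys F.0# d) λ b → term-cong β k (Fθ.∙-identityˡ b)))
      (λ y y≉0 → trans
        (∑-polys-scale y y≉0 (F.sym (F.*-identityʳ y)) d (term β k) (term-cong β k))
        (∑-cong (A₊ d) (term-∙ β k div y y≉0))))

  L-vanishes : ∀ β k → 0 < k → (q ∸ 1) ∣ (β ℕ.+ k) → L β k ≈ 0#
  L-vanishes β k@(suc k′) _ div = begin
    L β k                       ≈⟨ sym (+-identityˡ (L β k)) ⟩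
    0# + L β k                  ≈⟨ +-congʳ {L β k} (sym (V₀.powerSum-vanishes true false β k N ℕ.≤-refl)) ⟩
    T β k N + L β k             ≈⟨ atOne-telescope A[t] N (T β k) (λ d → S d β k) (T-step β k div) ⟩
    term β k (F.0# ∷ []) + 0#   ≈⟨ +-identityʳ (term β k (F.0# ∷ [])) ⟩
    -- The zero polynomial alone makes up T(0). Its term vanishes through the factor 0^k, as k > 0;
    -- the factor with exponent β is 1 when β = 0.
    term β k (F.0# ∷ [])        ≈⟨ *-congˡ {χₜ (F.0# ∷ []) ^ β} 0^k≈0 ⟩
    χₜ (F.0# ∷ []) ^ β * 0#     ≈⟨ zeroʳ (χₜ (F.0# ∷ []) ^ β) ⟩
    0#                          ∎
    where
    -- The length at which `z` is cut off; it exceeds the number β + k of factors of a term, so T(N)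
    -- = 0.
    N = suc (β ℕ.+ k)
    ι0≈0 : const (F.0# ∷ []) ≈ 0#
    ι0≈0 = trans (embed-cong false Fθ.0∷[]) (embed-[] false)
    0^k≈0 : const (F.0# ∷ []) ^ k ≈ 0#
    0^k≈0 = trans (*-congʳ {const (F.0# ∷ []) ^ k′} ι0≈0) (zeroˡ (const (F.0# ∷ []) ^ k′))

  -- The specialisation θ = t = 0, a ring homomorphism onto 𝔽q, and power sums of the field.

  constantTerm : Carrier → F.Carrier
  constantTerm f = Fθ.coeff (PA.coeff f 0) 0

  private
    ct = constantTerm

  ct-cong : ∀ {f g} → f ≈ g → ct f F.≈ ct g
  ct-cong e = Fθ.at (PA.at e 0) 0

  ct-+ : ∀ f g → ct (f + g) F.≈ ct f F.+ ct g
  ct-+ f g = F.trans (Fθ.at (PA.coeff-+ f g 0) 0) (Fθ.coeff-+ (PA.coeff f 0) (PA.coeff g 0) 0)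

  ct-neg : ∀ f → ct (- f) F.≈ F.- ct f
  ct-neg f = F.trans (Fθ.at (PA.coeff-neg f 0) 0) (Fθ.coeff-neg (PA.coeff f 0) 0)

  ct-* : ∀ f g → ct (f * g) F.≈ ct f F.* ct g
  ct-* f g = F.trans (Fθ.at (coeff₀-* A f g) 0) (coeff₀-* 𝔽q (PA.coeff f 0) (PA.coeff g 0))

  ct-^ : ∀ f n → ct (f ^ n) F.≈ ct f ^F n
  ct-^ f zero    = F.refl
  ct-^ f (suc n) = F.trans (ct-* f (f ^ n)) (F.*-congˡ (ct-^ f n))

  ct-∑ : {X : Set a} (xs : List X) (g : X → Carrier) → ct (∑ xs g) F.≈ ∑F.∑ xs (ct ∘ g)
  ct-∑ []       g = F.refl
  ct-∑ (x ∷ xs) g = F.trans (ct-+ (g x) (∑ xs g)) (F.+-congˡ (ct-∑ xs g))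

  -- `ct` is a left inverse of `ι`, so q r = 0 descends from A[t] to 𝔽q.
  elements-killF : ∀ r → ∑F.∑ elements (λ _ → r) F.≈ F.0#
  elements-killF r = F.trans (F.sym (ct-∑ elements (λ _ → ι r))) (ct-cong (elements-kill (ι r)))

  powerSum : ℕ → F.Carrier
  powerSum n = ∑F.∑ elements (_^F n)

  -- Each nonzero y contributes 1, and 0 contributes nothing because n > 0.
  powerSum-∣ : ∀ n → 0 < n → (q ∸ 1) ∣ n → powerSum n F.+ F.1# F.≈ F.0#
  powerSum-∣ n@(suc _) _ (divides j n≡) =
    F.trans (∑-nonzero-constant 𝔽q elements-killF (_^F n) F.1# (^F-congˡ n)
              (λ y y≉0 → F.trans (^F-congʳ y n≡) (^-multiple y y≉0 j)))
            (F.zeroˡ _)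

  powerSum-scale : ∀ n y → ¬ (y F.≈ F.0#) → powerSum n F.* y ^F n F.≈ powerSum n
  powerSum-scale n y y≉0 = F.trans (F.*-comm _ _) (F.sym
    (F.trans (∑-elements-scale 𝔽q y y≉0 (_^F n) (^F-congˡ n))
      (F.trans (∑F.∑-cong elements (λ x → ^F-distrib-* y x n)) (∑F.∑-*ˡ elements (y ^F n) (_^F n)))))

  -- Substituting yx for x gives s yⁿ = s; a nonzero s cancels, leaving yⁿ = 1 for every nonzero y.
  powerSum-nonzero⇒∣ : ∀ n → ¬ (powerSum n F.≈ F.0#) → (q ∸ 1) ∣ n
  powerSum-nonzero⇒∣ n s≉0 = all-roots-of-unity⇒∣ n λ y y≉0 →
    *-cancelˡ-nonzero s≉0 (F.trans (powerSum-scale n y y≉0) (F.sym (F.*-identityʳ _)))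

  -- Both `χₜ b` and `const b` specialise to b(0), so only the sum of the exponents survives.
  ct-term : ∀ β k b → ct (term β k b) F.≈ Fθ.coeff b 0 ^F (β ℕ.+ k)
  ct-term β k b = F.trans (ct-* (χₜ b ^ β) (const b ^ k))
    (F.trans (F.*-cong (F.trans (ct-^ (χₜ b) β) (^F-congˡ β (Fθ.at (coeff-χₜ b 0) 0))) (ct-^ (const b) k))
      (F.sym (^F-homo-* (Fθ.coeff b 0) β k)))

  ct-S : ∀ d β k → ct (S d β k) F.≈ ∑F.∑ (A₊ d) (λ b → Fθ.coeff b 0 ^F (β ℕ.+ k))
  ct-S d β k = F.trans (ct-∑ (A₊ d) (term β k)) (∑F.∑-cong (A₊ d) (ct-term β k))

  ct-S-suc : ∀ d β k → ct (S (suc d) β k) F.≈ ∑F.∑ elements (λ x → ∑F.∑ (A₊ d) (λ _ → x ^F (β ℕ.+ k)))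
  ct-S-suc d β k = F.trans (ct-S (suc d) β k) (∑-polys-suc 𝔽q F.1# d _)

  ct-S₀ : ∀ β k → ct (S 0 β k) F.≈ F.1#
  ct-S₀ β k = F.trans (ct-S 0 β k) (F.trans (F.+-identityʳ _) (1^n≈1 (β ℕ.+ k)))

  ct-S₁ : ∀ β k → ct (S 1 β k) F.≈ powerSum (β ℕ.+ k)
  ct-S₁ β k = F.trans (ct-S-suc 0 β k) (∑F.∑-cong elements λ x → F.+-identityʳ _)

  -- From degree 2 on, the coefficient of θ is free and does not affect the summand, so summing over
  -- it gives a multiple of q.
  ct-S₂₊ : ∀ β k d → ct (S (suc (suc d)) β k) F.≈ F.0#
  ct-S₂₊ β k d = F.trans (ct-S-suc (suc d) β k) (F.trans
    (∑F.∑-cong elements λ x → F.trans (∑-polys-suc 𝔽q F.1# d _) (elements-killF _))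
    (∑-zero 𝔽q elements))

  -- The value and the derivative at x = 1 after specialisation.

  open InverseVariable A[t] using (negDegreeScale)
  open Mult +-monoid using () renaming (_×_ to _·_)

  ct-· : ∀ n f → ct f F.≈ F.0# → ct (n · f) F.≈ F.0#
  ct-· zero    f e = F.refl
  ct-· (suc n) f e = F.trans (ct-+ f (n · f)) (F.trans (F.+-cong e (ct-· n f e)) (F.+-identityˡ _))

  ct-atOne-∷ : ∀ r f → ct (atOne (r ∷ f)) F.≈ ct r F.+ ct (atOne f)
  ct-atOne-∷ r f = F.trans (ct-+ r (1# * atOne f)) (F.+-congˡ (ct-cong (*-identityˡ (atOne f))))

  ct-atOne-zeros : ∀ f → All (λ r → ct r F.≈ F.0#) f → ct (atOne f) F.≈ F.0#
  ct-atOne-zeros []      []       = F.refl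
  ct-atOne-zeros (r ∷ f) (e ∷ es) = F.trans (ct-atOne-∷ r f)
    (F.trans (F.+-cong e (ct-atOne-zeros f es)) (F.+-identityˡ _))

  ct-atOne-linear : ∀ r s f → All (λ r → ct r F.≈ F.0#) f → ct (atOne (r ∷ s ∷ f)) F.≈ ct r F.+ ct s
  ct-atOne-linear r s f es = F.trans (ct-atOne-∷ r (s ∷ f)) (F.+-congˡ
    (F.trans (ct-atOne-∷ s f) (F.trans (F.+-congˡ (ct-atOne-zeros f es)) (F.+-identityʳ _))))

  open RingProperties F.ring using (-0#≈0#; +-inverseʳ-unique)

  negDegreeScale-zeros : ∀ d f → All (λ r → ct r F.≈ F.0#) f → All (λ r → ct r F.≈ F.0#) (negDegreeScale d f)
  negDegreeScale-zeros d []      []       = []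
  negDegreeScale-zeros d (r ∷ f) (e ∷ es) =
    F.trans (ct-neg (d · r)) (F.trans (F.-‿cong (ct-· d r e)) -0#≈0#) ∷ negDegreeScale-zeros (suc d) f es

  module _ (s : ℕ → Carrier) (s₂₊ : ∀ d → ct (s (suc (suc d))) F.≈ F.0#) where

    ct-atOne : ∀ N → 2 ≤ N → ct (atOne (applyUpTo s N)) F.≈ ct (s 0) F.+ ct (s 1)
    ct-atOne (suc (suc N)) (s≤s (s≤s _)) = ct-atOne-linear (s 0) (s 1) _ (AllP.applyUpTo⁺₂ _ N s₂₊)

    ct-atOne-∂ : ∀ N → 2 ≤ N → ct (atOne (∂/∂x (applyUpTo s N))) F.≈ F.- ct (s 1)
    ct-atOne-∂ (suc (suc N)) (s≤s (s≤s _)) =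
      -- The leading `0#` is the shift by x⁻¹ in `∂/∂x`; the next coefficient, from the constant
      -- term of the polynomial, reduces to `- 0#`.
      F.trans (ct-atOne-∷ 0# (negDegreeScale 0 (applyUpTo s (suc (suc N))))) (F.trans (F.+-identityˡ _)
      (F.trans (ct-atOne-linear (- 0#) (- (1 · s 1)) _
                 (negDegreeScale-zeros 2 _ (AllP.applyUpTo⁺₂ _ N s₂₊)))
      (F.trans (F.+-identityˡ _)
      (F.trans (ct-neg (1 · s 1)) (F.-‿cong (ct-cong (+-identityʳ (s 1))))))))

  -- Ensures that the cut-off of `z` keeps the terms of degree 0 and 1.
  2≤1+β+k : ∀ β {k} → 0 < k → 2 ≤ suc (β ℕ.+ k)
  2≤1+β+k β {k} k>0 = s≤s (ℕ.≤-trans k>0 (ℕ.m≤n+m k β))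

  -- L specialises to 1 + s. If L were 0, then s = 0 would give 1 = 0, while s ≠ 0 forces q - 1 to
  -- divide β + k.
  L-nonzero : ∀ β k → 0 < k → ¬ ((q ∸ 1) ∣ (β ℕ.+ k)) → ¬ (L β k ≈ 0#)
  L-nonzero β k k>0 ∤ L≈0 = ∤ (powerSum-nonzero⇒∣ (β ℕ.+ k) λ s≈0 → 1≉0
    (F.trans (F.sym (F.+-identityʳ F.1#)) (F.trans (F.sym (F.+-cong (ct-S₀ β k) (F.trans (ct-S₁ β k) s≈0)))
      (F.trans (F.sym (ct-atOne (λ d → S d β k) (ct-S₂₊ β k) _ (2≤1+β+k β k>0))) (ct-cong L≈0)))))

  -- The derivative at x = 1 specialises to -s, which is 1 under the divisibility assumption.
  ∂z-nonzero : ∀ β k → 0 < k → (q ∸ 1) ∣ (β ℕ.+ k) → ¬ (atOne (∂/∂x (z β k)) ≈ 0#)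
  ∂z-nonzero β k k>0 div ∂≈0 = 1≉0 (F.trans (F.sym -s≈1) (F.trans
      (F.sym (F.trans (ct-atOne-∂ (λ d → S d β k) (ct-S₂₊ β k) _ (2≤1+β+k β k>0)) (F.-‿cong (ct-S₁ β k))))
      (ct-cong ∂≈0)))
    where
    -s≈1 : F.- powerSum (β ℕ.+ k) F.≈ F.1#
    -s≈1 = F.sym (+-inverseʳ-unique _ _ (powerSum-∣ (β ℕ.+ k) (ℕ.≤-trans k>0 (ℕ.m≤n+m k β)) div))

open import Data.Nat using (_+_; _^_)

theorem2p0p3 : ∀ {c ℓ} (p e q : ℕ) → Prime p → 0 < e → q ≡ p ^ e →
  (𝔽 : FiniteField c ℓ q) →
  let open Pellarin 𝔽
      module A[t] = CommutativeRing A[t]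
  in
  (β k : ℕ) → 0 < k →
    ((q ∸ 1) ∣ (β + k) → L β k A[t].≈ A[t].0#)
    × (¬ ((q ∸ 1) ∣ (β + k)) → ¬ (L β k A[t].≈ A[t].0#))
    × ((q ∸ 1) ∣ (β + k) → ¬ (atOne (∂/∂x (z β k)) A[t].≈ A[t].0#))
theorem2p0p3 p e q _ _ _ 𝔽 β k k>0 =
  L-vanishes β k k>0 , L-nonzero β k k>0 , ∂z-nonzero β k k>0
  where open PellarinProperties 𝔽
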